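{- Let $a = 1+\sqrt{2}$ and $b = 1-\sqrt{2} = -1/a$. For every positive integer $N$ and every integer $n\ge 0$, $$\sum_{i=0}^{4N-1} P(n+i) = \frac{a^{2N}-b^{2N}}{\sqrt{2}}\, P(n+2N).$$ In particular, the sum of any $4N$ consecutive Pell numbers equals a constant depending only on $N$ times the $(2N+1)$-st of these consecutive terms.
   Context: The Pell numbers are defined by $P(0)=0$, $P(1)=1$ and $P(n)=2P(n-1)+P(n-2)$ for $n\ge 2$. -}

module Defs where

open import Algebra.Bundles using (CommutativeRing; Semiring)
import Algebra.Definitions.RawSemiring
open import Data.Integer.Base using (+_)
open import Data.List.Base using (List; map; upTo)
open import Data.Nat.Base as ℕ using (ℕ; suc)
open import Data.Product.Base using (_,_)
open import Data.Rational.Base as ℚ using (ℚ; 0ℚ; 1ℚ; NonZero)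
import Data.Rational.Properties as ℚ
open import Data.Rational.Solver using (module +-*-Solver)
open import Level using (0ℓ)
open import Relation.Binary.PropositionalEquality

P : ℕ → ℕ
P 0             = 0
P 1             = 1
P (suc (suc n)) = 2 ℕ.* P (suc n) ℕ.+ P n

-- P n, P (n + 1), …, P (n + k - 1)
consecutiveP : (n k : ℕ) → List ℕ
consecutiveP n k = map (λ i → P (n ℕ.+ i)) (upTo k)

-- The subfield ℚ(√2) of ℝ; the pair  p +√2· q  stands for the real number
-- p + q √2.  As √2 is irrational, distinct pairs are distinct reals, so
-- propositional equality of pairs is equality of real numbers.

infix 5 _+√2·_

record ℚ√2 : Set where
  constructor _+√2·_
  field
    rat  : ℚ
    surd : ℚ

infix  8 -_
infixl 7 _*_ _/_
infixl 6 _+_ _-_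

_+_ _-_ _*_ : ℚ√2 → ℚ√2 → ℚ√2
(p +√2· q) + (r +√2· s) = (p ℚ.+ r) +√2· (q ℚ.+ s)
(p +√2· q) - (r +√2· s) = (p ℚ.- r) +√2· (q ℚ.- s)
(p +√2· q) * (r +√2· s) =
  (p ℚ.* r ℚ.+ (1ℚ ℚ.+ 1ℚ) ℚ.* (q ℚ.* s)) +√2· (p ℚ.* s ℚ.+ q ℚ.* r)

-_ : ℚ√2 → ℚ√2
- (p +√2· q) = (ℚ.- p) +√2· (ℚ.- q)

0√ 1√ √2 : ℚ√2
0√ = 0ℚ +√2· 0ℚ
1√ = 1ℚ +√2· 0ℚ
√2 = 0ℚ +√2· 1ℚ

fromℕ : ℕ → ℚ√2
fromℕ m = (+ m ℚ./ 1) +√2· 0ℚ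

norm : ℚ√2 → ℚ
norm (p +√2· q) = p ℚ.* p ℚ.- (1ℚ ℚ.+ 1ℚ) ℚ.* (q ℚ.* q)

-- 1 / (p + q √2) = (p - q √2) / (p² - 2 q²).  The norm vanishes only at 0√,
-- so the side condition says that the divisor is nonzero.
recip : (y : ℚ√2) .{{_ : NonZero (norm y)}} → ℚ√2
recip y@(p +√2· q) = (p ℚ.* ℚ.1/ norm y) +√2· (ℚ.- q ℚ.* ℚ.1/ norm y)

_/_ : (x y : ℚ√2) .{{_ : NonZero (norm y)}} → ℚ√2
x / y = x * recip y

private
  open +-*-Solver

  2′ : ∀ {n} → Polynomial n
  2′ = con 1ℚ :+ con 1ℚ

√2*√2≡2 : √2 * √2 ≡ fromℕ 2
√2*√2≡2 = refl

*-recip : ∀ y .{{_ : NonZero (norm y)}} → y * recip y ≡ 1√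
*-recip y@(p +√2· q) = cong₂ _+√2·_
  (trans
    (solve 3 (λ p q i → p :* (p :* i) :+ 2′ :* (q :* (:- q :* i))
                      := (p :* p :- 2′ :* (q :* q)) :* i)
             refl p q (ℚ.1/ norm y))
    (ℚ.*-inverseʳ (norm y)))
  (solve 3 (λ p q i → p :* (:- q :* i) :+ q :* (p :* i) := con 0ℚ)
           refl p q (ℚ.1/ norm y))

commutativeRing : CommutativeRing 0ℓ 0ℓ
commutativeRing = record
  { Carrier = ℚ√2 ; _≈_ = _≡_ ; _+_ = _+_ ; _*_ = _*_ ; -_ = λ x → - x
  ; 0# = 0√ ; 1# = 1√
  ; isCommutativeRing = record
    { isRing = record
      { +-isAbelianGroup = record
        { isGroup = record
          { isMonoid = record
            { isSemigroup = record
              { isMagma = record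
                { isEquivalence = isEquivalence ; ∙-cong = cong₂ _+_ }
              ; assoc = λ (p +√2· q) (r +√2· s) (t +√2· u) →
                  cong₂ _+√2·_ (ℚ.+-assoc p r t) (ℚ.+-assoc q s u)
              }
            ; identity =
                (λ (p +√2· q) → cong₂ _+√2·_ (ℚ.+-identityˡ p) (ℚ.+-identityˡ q))
              , (λ (p +√2· q) → cong₂ _+√2·_ (ℚ.+-identityʳ p) (ℚ.+-identityʳ q))
            }
          ; inverse =
              (λ (p +√2· q) → cong₂ _+√2·_ (ℚ.+-inverseˡ p) (ℚ.+-inverseˡ q))
            , (λ (p +√2· q) → cong₂ _+√2·_ (ℚ.+-inverseʳ p) (ℚ.+-inverseʳ q))
          ; ⁻¹-cong = cong (λ x → - x)
          }
        ; comm = λ (p +√2· q) (r +√2· s) →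
            cong₂ _+√2·_ (ℚ.+-comm p r) (ℚ.+-comm q s)
        }
      ; *-cong = cong₂ _*_
      ; *-assoc = λ (p +√2· q) (r +√2· s) (t +√2· u) → cong₂ _+√2·_
          (solve 6 (λ p q r s t u →
             (p :* r :+ 2′ :* (q :* s)) :* t :+ 2′ :* ((p :* s :+ q :* r) :* u)
             := p :* (r :* t :+ 2′ :* (s :* u)) :+ 2′ :* (q :* (r :* u :+ s :* t)))
             refl p q r s t u)
          (solve 6 (λ p q r s t u →
             (p :* r :+ 2′ :* (q :* s)) :* u :+ (p :* s :+ q :* r) :* t
             := p :* (r :* u :+ s :* t) :+ q :* (r :* t :+ 2′ :* (s :* u)))
             refl p q r s t u)
      ; *-identity =
          (λ (p +√2· q) → cong₂ _+√2·_
            (solve 2 (λ p q → con 1ℚ :* p :+ 2′ :* (con 0ℚ :* q) := p) refl p q)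
            (solve 2 (λ p q → con 1ℚ :* q :+ con 0ℚ :* p := q) refl p q))
        , (λ (p +√2· q) → cong₂ _+√2·_
            (solve 2 (λ p q → p :* con 1ℚ :+ 2′ :* (q :* con 0ℚ) := p) refl p q)
            (solve 2 (λ p q → p :* con 0ℚ :+ q :* con 1ℚ := q) refl p q))
      ; distrib =
          (λ (p +√2· q) (r +√2· s) (t +√2· u) → cong₂ _+√2·_
            (solve 6 (λ p q r s t u →
               p :* (r :+ t) :+ 2′ :* (q :* (s :+ u))
               := (p :* r :+ 2′ :* (q :* s)) :+ (p :* t :+ 2′ :* (q :* u)))
               refl p q r s t u)
            (solve 6 (λ p q r s t u →
               p :* (s :+ u) :+ q :* (r :+ t)
               := (p :* s :+ q :* r) :+ (p :* u :+ q :* t))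
               refl p q r s t u))
        , (λ (p +√2· q) (r +√2· s) (t +√2· u) → cong₂ _+√2·_
            (solve 6 (λ p q r s t u →
               (r :+ t) :* p :+ 2′ :* ((s :+ u) :* q)
               := (r :* p :+ 2′ :* (s :* q)) :+ (t :* p :+ 2′ :* (u :* q)))
               refl p q r s t u)
            (solve 6 (λ p q r s t u →
               (r :+ t) :* q :+ (s :+ u) :* p
               := (r :* q :+ s :* p) :+ (t :* q :+ u :* p))
               refl p q r s t u))
      }
    ; *-comm = λ (p +√2· q) (r +√2· s) → cong₂ _+√2·_
        (solve 4 (λ p q r s → p :* r :+ 2′ :* (q :* s) := r :* p :+ 2′ :* (s :* q))
          refl p q r s)
        (solve 4 (λ p q r s → p :* s :+ q :* r := r :* q :+ s :* p) refl p q r s)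
    }
  }

open Algebra.Definitions.RawSemiring
  (Semiring.rawSemiring (CommutativeRing.semiring commutativeRing)) public using (_^_)

a b : ℚ√2
a = 1√ + √2
b = 1√ - √2

{-# OPTIONS --safe #-}
-- For every n, and with M even,
--   4 P(M) P(M + n) = (P(2M + n + 1) - P(2M + n)) - (P(n + 1) - P(n)),
-- the sign of the last difference being reversed for odd M.  Since
-- 2 P(i) = (P(i + 1) - P(i)) - (P(i) - P(i - 1)), twice a sum of consecutive
-- terms telescopes; for 4N terms starting at P(n) it equals this right-hand
-- side with M = 2N.  Hence the sum is 2 P(2N) P(n + 2N), and
-- 2 P(M) = (a ^ M - b ^ M) / √2 by Binet's formula.
module Submission where

open import Defs
open import Algebra.Bundles using (CommutativeRing)
import Data.Integer.Base as ℤ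
import Data.Integer.Properties as ℤ
open import Data.List.Base using (applyUpTo; [_]; _++_)
open import Data.List.Properties using (applyUpTo-∷ʳ; map-upTo)
open import Data.Nat.ListAction using (sum)
open import Data.Nat.ListAction.Properties using (sum-++)
open import Data.Nat.Base as ℕ using (ℕ; zero; suc)
import Data.Nat.Properties as ℕ
import Data.Nat.Solver as ℕ
open import Data.Product.Base using (_×_; ∃-syntax; _,_; proj₁)
open import Data.Rational.Base as ℚ using (ℚ; 0ℚ; 1ℚ)
open import Data.Rational.Literals using (fromℤ)
import Data.Rational.Properties as ℚ
import Data.Rational.Solver as ℚ
open import Relation.Binary.PropositionalEquality
  using (_≡_; refl; sym; trans; cong; cong₂; module ≡-Reasoning)

-- The differences are moved across the equation so that it lives in ℕ. The parity in each name is
-- that of the `M` for which the equation will be proved.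
EvenProduct OddProduct : ℕ → Set
EvenProduct M = ∀ n →
  4 ℕ.* (P M ℕ.* P (M ℕ.+ n)) ℕ.+ (P (M ℕ.+ (M ℕ.+ n)) ℕ.+ P (suc n))
    ≡ P (suc (M ℕ.+ (M ℕ.+ n))) ℕ.+ P n
OddProduct M = ∀ n →
  4 ℕ.* (P M ℕ.* P (M ℕ.+ n)) ℕ.+ (P (M ℕ.+ (M ℕ.+ n)) ℕ.+ P n)
    ≡ P (suc (M ℕ.+ (M ℕ.+ n))) ℕ.+ P (suc n)

module _ where
  open ℕ.+-*-Solver

  -- Subtraction-free form of l - r = (l₁ - r₁) + 2 (l₂ - r₂), which leaves only a semiring identity
  -- to the solver. The weights 1 and 2 are those of the Pell recurrence.
  linear-combination : ∀ {l₁ r₁ l₂ r₂ l r} → l₁ ≡ r₁ → l₂ ≡ r₂ →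
    l ℕ.+ (r₁ ℕ.+ 2 ℕ.* r₂) ≡ r ℕ.+ (l₁ ℕ.+ 2 ℕ.* l₂) → l ≡ r
  linear-combination {l₁} {l₂ = l₂} refl refl = ℕ.+-cancelʳ-≡ (l₁ ℕ.+ 2 ℕ.* l₂) _ _

  private
    next : ∀ {k} → Polynomial k → Polynomial k → Polynomial k
    next x y = con 2 :* y :+ x

  -- P(M + 2) P(M + 2 + n) = P(M) P(M + (n + 2)) + 2 P(M + 1) P(M + 1 + (n + 1)),
  -- so the claim is the combination of those for (M, n + 2) and (M + 1, n + 1).
  evenProduct-step : ∀ M → EvenProduct M → OddProduct (suc M) → EvenProduct (2 ℕ.+ M)
  evenProduct-step M even odd n
    with even₂ ← even (2 ℕ.+ n) | odd₁ ← odd (1 ℕ.+ n)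
    rewrite ℕ.+-suc M (suc n) | ℕ.+-suc M n
          | ℕ.+-suc M (suc (M ℕ.+ n)) | ℕ.+-suc M (M ℕ.+ n)
    = linear-combination even₂ odd₁
        (solve 7
          (λ p q f x y u v →
             let x₂ = next x y ; x₃ = next y x₂
                 u₂ = next u v ; u₃ = next v u₂ ; u₄ = next u₂ u₃ ; u₅ = next u₃ u₄
             in (con 4 :* (next p q :* f) :+ (u₄ :+ y))
                  :+ ((u₃ :+ x₂) :+ con 2 :* (u₄ :+ x₂))
                := (u₅ :+ x)
                  :+ ((con 4 :* (p :* f) :+ (u₂ :+ x₃)) :+ con 2 :* (con 4 :* (q :* f) :+ (u₃ :+ y))))
          refl (P M) (P (suc M)) (P (2 ℕ.+ (M ℕ.+ n))) (P n) (P (suc n))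
          (P (M ℕ.+ (M ℕ.+ n))) (P (suc (M ℕ.+ (M ℕ.+ n)))))

  -- The same combination with parities exchanged. For D(i) = P(i + 1) - P(i), the recurrence gives
  -- D(n) = D(n + 2) - 2 D(n + 1), and the opposite parity at M + 1 supplies the minus sign.
  oddProduct-step : ∀ M → OddProduct M → EvenProduct (suc M) → OddProduct (2 ℕ.+ M)
  oddProduct-step M odd even n
    with odd₂ ← odd (2 ℕ.+ n) | even₁ ← even (1 ℕ.+ n)
    -- Successors move outward until every term is built from the seven atoms below; the factor
    -- `P (2 ℕ.+ (M ℕ.+ n))` is common to all three products.
    rewrite ℕ.+-suc M (suc n) | ℕ.+-suc M n
          | ℕ.+-suc M (suc (M ℕ.+ n)) | ℕ.+-suc M (M ℕ.+ n)
    = linear-combination odd₂ even₁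
        (solve 7
          (λ p q f x y u v →
             let x₂ = next x y ; x₃ = next y x₂
                 u₂ = next u v ; u₃ = next v u₂ ; u₄ = next u₂ u₃ ; u₅ = next u₃ u₄
             in (con 4 :* (next p q :* f) :+ (u₄ :+ x))
                  :+ ((u₃ :+ x₃) :+ con 2 :* (u₄ :+ y))
                := (u₅ :+ y)
                  :+ ((con 4 :* (p :* f) :+ (u₂ :+ x₂)) :+ con 2 :* (con 4 :* (q :* f) :+ (u₃ :+ x₂))))
          refl (P M) (P (suc M)) (P (2 ℕ.+ (M ℕ.+ n))) (P n) (P (suc n))
          (P (M ℕ.+ (M ℕ.+ n))) (P (suc (M ℕ.+ (M ℕ.+ n)))))

  -- Each step needs the two preceding values of M, so the induction carries a pair. The form
  -- `N ℕ.* 2` makes `suc N ℕ.* 2` reduce to `2 ℕ.+ N ℕ.* 2`.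
  evenOddProducts : ∀ N → EvenProduct (N ℕ.* 2) × OddProduct (suc (N ℕ.* 2))
  evenOddProducts zero =
    (λ n → ℕ.+-comm (P n) (P (suc n))) ,
    (λ n → solve 2
      (λ x y → con 4 :* (con 1 :* y) :+ (next x y :+ x) := next y (next x y) :+ y)
      refl (P n) (P (suc n)))
  evenOddProducts (suc N) with even , odd ← evenOddProducts N = even′ , oddProduct-step (suc (N ℕ.* 2)) odd even′
    where even′ = evenProduct-step (N ℕ.* 2) even odd

  -- `upTo` unfolds at the front, while telescoping adds the last term.
  sum-consecutiveP-suc : ∀ n k →
    sum (consecutiveP n (suc k)) ≡ sum (consecutiveP n k) ℕ.+ P (n ℕ.+ k)
  sum-consecutiveP-suc n k = begin
    sum (consecutiveP n (suc k))           ≡⟨ cong sum (map-upTo f (suc k)) ⟩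
    sum (applyUpTo f (suc k))              ≡⟨ cong sum (applyUpTo-∷ʳ f k) ⟨
    sum (applyUpTo f k ++ [ f k ])         ≡⟨ sum-++ (applyUpTo f k) [ f k ] ⟩
    sum (applyUpTo f k) ℕ.+ (f k ℕ.+ 0)    ≡⟨ cong₂ (λ fs m → sum fs ℕ.+ m) (sym (map-upTo f k))
                                                    (ℕ.+-identityʳ (f k)) ⟩
    sum (consecutiveP n k) ℕ.+ f k         ∎
    where
    open ≡-Reasoning
    f = λ i → P (n ℕ.+ i)

  -- Since 2 P(i) = (P(i + 2) - P(i + 1)) - (P(i + 1) - P(i)), only the two end differences survive.
  sum-consecutiveP-telescopes : ∀ n k →
    2 ℕ.* sum (consecutiveP n k) ℕ.+ (P (k ℕ.+ n) ℕ.+ P (suc n)) ≡ P (suc (k ℕ.+ n)) ℕ.+ P n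
  sum-consecutiveP-telescopes n zero = ℕ.+-comm (P n) (P (suc n))
  sum-consecutiveP-telescopes n (suc k)
    rewrite sum-consecutiveP-suc n k | ℕ.+-comm n k
    -- The induction hypothesis enters with weight 1; the trivial 0 = 0 fills the slot of weight 2.
    = linear-combination (sum-consecutiveP-telescopes n k) (refl {x = 0})
        (solve 5
          (λ s u v x y →
             (con 2 :* (s :+ u) :+ (v :+ y)) :+ (v :+ x :+ con 0)
               := (next u v :+ x) :+ (con 2 :* s :+ (u :+ y) :+ con 0))
          refl (sum (consecutiveP n k)) (P (k ℕ.+ n)) (P (suc (k ℕ.+ n))) (P n) (P (suc n)))

  sum-consecutiveP : ∀ n N →
    sum (consecutiveP n (4 ℕ.* N)) ≡ (2 ℕ.* P (2 ℕ.* N)) ℕ.* P (n ℕ.+ 2 ℕ.* N)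
  -- After doubling and adding the same two terms, both sides equal P(4N + n + 1) + P(n).
  sum-consecutiveP n N = ℕ.*-cancelˡ-≡ _ _ 2 (ℕ.+-cancelʳ-≡ (P (4 ℕ.* N ℕ.+ n) ℕ.+ P (suc n)) _ _ (begin
      2 ℕ.* sum (consecutiveP n (4 ℕ.* N)) ℕ.+ (P (4 ℕ.* N ℕ.+ n) ℕ.+ P (suc n))
        ≡⟨ sum-consecutiveP-telescopes n (4 ℕ.* N) ⟩
      P (suc (4 ℕ.* N ℕ.+ n)) ℕ.+ P n
        ≡⟨ cong (λ i → P (suc i) ℕ.+ P n) 4N+n ⟩
      P (suc (M ℕ.+ (M ℕ.+ n))) ℕ.+ P n
        ≡⟨ proj₁ (evenOddProducts N) n ⟨
      4 ℕ.* (P M ℕ.* P (M ℕ.+ n)) ℕ.+ (P (M ℕ.+ (M ℕ.+ n)) ℕ.+ P (suc n))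
        ≡⟨ cong (λ i → 4 ℕ.* (P M ℕ.* P (M ℕ.+ n)) ℕ.+ (P i ℕ.+ P (suc n))) 4N+n ⟨
      4 ℕ.* (P M ℕ.* P (M ℕ.+ n)) ℕ.+ (P (4 ℕ.* N ℕ.+ n) ℕ.+ P (suc n))
        ≡⟨ cong (ℕ._+ (P (4 ℕ.* N ℕ.+ n) ℕ.+ P (suc n))) (begin
             4 ℕ.* (P M ℕ.* P (M ℕ.+ n))
               ≡⟨ cong₂ (λ i j → 4 ℕ.* (P i ℕ.* P j)) (ℕ.*-comm N 2)
                    (trans (ℕ.+-comm M n) (cong (n ℕ.+_) (ℕ.*-comm N 2))) ⟩
             4 ℕ.* (P (2 ℕ.* N) ℕ.* P (n ℕ.+ 2 ℕ.* N))
               ≡⟨ solve 2 (λ p f → con 4 :* (p :* f) := con 2 :* (con 2 :* p :* f)) refl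
                    (P (2 ℕ.* N)) (P (n ℕ.+ 2 ℕ.* N)) ⟩
             2 ℕ.* (2 ℕ.* P (2 ℕ.* N) ℕ.* P (n ℕ.+ 2 ℕ.* N)) ∎) ⟩
      2 ℕ.* (2 ℕ.* P (2 ℕ.* N) ℕ.* P (n ℕ.+ 2 ℕ.* N)) ℕ.+ (P (4 ℕ.* N ℕ.+ n) ℕ.+ P (suc n)) ∎))
    where
    open ≡-Reasoning
    M = N ℕ.* 2
    4N+n : 4 ℕ.* N ℕ.+ n ≡ M ℕ.+ (M ℕ.+ n)
    4N+n = solve 2 (λ N n → con 4 :* N :+ n := N :* con 2 :+ (N :* con 2 :+ n)) refl N n

fromℕ-ℚ : ℕ → ℚ
fromℕ-ℚ m = ℤ.+ m ℚ./ 1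

-- For variable `m`, division by 1 is stuck on gcd normalisation; `fromℤ` exposes numerator and
-- denominator, so that ℚ operations reduce.
fromℕ-ℚ≡fromℤ : ∀ m → fromℕ-ℚ m ≡ fromℤ (ℤ.+ m)
fromℕ-ℚ≡fromℤ m = ℚ.↥p/↧p≡p (fromℤ (ℤ.+ m))

fromℕ-ℚ-homo-+ : ∀ m n → fromℕ-ℚ (m ℕ.+ n) ≡ fromℕ-ℚ m ℚ.+ fromℕ-ℚ n
fromℕ-ℚ-homo-+ m n rewrite fromℕ-ℚ≡fromℤ m | fromℕ-ℚ≡fromℤ n =
  cong (ℚ._/ 1) (sym (cong₂ ℤ._+_ (ℤ.*-identityʳ (ℤ.+ m)) (ℤ.*-identityʳ (ℤ.+ n))))

fromℕ-ℚ-homo-* : ∀ m n → fromℕ-ℚ (m ℕ.* n) ≡ fromℕ-ℚ m ℚ.* fromℕ-ℚ n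
fromℕ-ℚ-homo-* m n rewrite fromℕ-ℚ≡fromℤ m | fromℕ-ℚ≡fromℤ n =
  cong (ℚ._/ 1) (ℤ.pos-* m n)

module _ where
  open ℚ.+-*-Solver

  private
    2′ : ∀ {k} → Polynomial k
    2′ = con 1ℚ :+ con 1ℚ

  fromℕ-homo-* : ∀ m n → fromℕ (m ℕ.* n) ≡ fromℕ m * fromℕ n
  fromℕ-homo-* m n = cong₂ _+√2·_
    (trans (fromℕ-ℚ-homo-* m n)
      (solve 2 (λ p q → p :* q := p :* q :+ 2′ :* (con 0ℚ :* con 0ℚ)) refl
        (fromℕ-ℚ m) (fromℕ-ℚ n)))
    (solve 2 (λ p q → con 0ℚ := p :* con 0ℚ :+ con 0ℚ :* q) refl
      (fromℕ-ℚ m) (fromℕ-ℚ n))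

  fromℕ-ℚ-P-recurrence : ∀ m → fromℕ-ℚ (P (2 ℕ.+ m))
    ≡ (1ℚ ℚ.+ 1ℚ) ℚ.* fromℕ-ℚ (P (suc m)) ℚ.+ fromℕ-ℚ (P m)
  fromℕ-ℚ-P-recurrence m = trans (fromℕ-ℚ-homo-+ (2 ℕ.* P (suc m)) (P m))
    (cong (ℚ._+ fromℕ-ℚ (P m)) (fromℕ-ℚ-homo-* 2 (P (suc m))))

  -- Multiplying (y - x) + x√2 by 1 + √2 gives (y + x) + y√2, where y + x is the next difference.
  -- The rational parts are the half-companion Pell numbers.
  a^m : ∀ m → a ^ m ≡ (fromℕ-ℚ (P (suc m)) ℚ.- fromℕ-ℚ (P m)) +√2· fromℕ-ℚ (P m)
  a^m zero = refl
  a^m (suc m) rewrite a^m m | fromℕ-ℚ-P-recurrence m = cong₂ _+√2·_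
    (solve 2 (λ x y → (con 1ℚ :+ con 0ℚ) :* (y :- x) :+ 2′ :* ((con 0ℚ :+ con 1ℚ) :* x)
                     := 2′ :* y :+ x :- y) refl (fromℕ-ℚ (P m)) (fromℕ-ℚ (P (suc m))))
    (solve 2 (λ x y → (con 1ℚ :+ con 0ℚ) :* x :+ (con 0ℚ :+ con 1ℚ) :* (y :- x) := y)
             refl (fromℕ-ℚ (P m)) (fromℕ-ℚ (P (suc m))))

  -- The conjugate of `a^m`: in the difference the rational parts cancel and the surds double.
  b^m : ∀ m → b ^ m ≡ (fromℕ-ℚ (P (suc m)) ℚ.- fromℕ-ℚ (P m)) +√2· (ℚ.- fromℕ-ℚ (P m))
  b^m zero = refl
  b^m (suc m) rewrite b^m m | fromℕ-ℚ-P-recurrence m = cong₂ _+√2·_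
    (solve 2 (λ x y → (con 1ℚ :- con 0ℚ) :* (y :- x) :+ 2′ :* ((con 0ℚ :- con 1ℚ) :* (:- x))
                     := 2′ :* y :+ x :- y) refl (fromℕ-ℚ (P m)) (fromℕ-ℚ (P (suc m))))
    (solve 2 (λ x y → (con 1ℚ :- con 0ℚ) :* (:- x) :+ (con 0ℚ :- con 1ℚ) :* (y :- x) := :- y)
             refl (fromℕ-ℚ (P m)) (fromℕ-ℚ (P (suc m))))

  a^m-b^m : ∀ m → a ^ m - b ^ m ≡ fromℕ (2 ℕ.* P m) * √2
  a^m-b^m m rewrite a^m m | b^m m | fromℕ-ℚ-homo-* 2 (P m) = cong₂ _+√2·_
    (solve 2 (λ x y → (y :- x) :- (y :- x)
                     := 2′ :* x :* con 0ℚ :+ 2′ :* (con 0ℚ :* con 1ℚ))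
             refl (fromℕ-ℚ (P m)) (fromℕ-ℚ (P (suc m))))
    (solve 1 (λ x → x :- (:- x) := 2′ :* x :* con 1ℚ :+ con 0ℚ :* con 0ℚ)
             refl (fromℕ-ℚ (P m)))

binet : ∀ m → fromℕ (2 ℕ.* P m) ≡ (a ^ m - b ^ m) / √2
binet m = begin
  fromℕ (2 ℕ.* P m)                      ≡⟨ *-identityʳ (fromℕ (2 ℕ.* P m)) ⟨
  fromℕ (2 ℕ.* P m) * 1√                 ≡⟨ cong (fromℕ (2 ℕ.* P m) *_) (*-recip √2) ⟨
  fromℕ (2 ℕ.* P m) * (√2 * recip √2)    ≡⟨ *-assoc (fromℕ (2 ℕ.* P m)) √2 (recip √2) ⟨
  fromℕ (2 ℕ.* P m) * √2 / √2            ≡⟨ cong (λ x → x / √2) (a^m-b^m m) ⟨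
  (a ^ m - b ^ m) / √2                   ∎
  where
  open ≡-Reasoning
  open CommutativeRing commutativeRing using (*-identityʳ; *-assoc)

theorem1p6 : (b ≡ - 1√ / a) ×
    ((N : ℕ) .{{_ : ℕ.NonZero N}} →
    ((n : ℕ) →
    fromℕ (sum (consecutiveP n (4 ℕ.* N)))
    ≡ (a ^ (2 ℕ.* N) - b ^ (2 ℕ.* N)) / √2 * fromℕ (P (n ℕ.+ 2 ℕ.* N))) ×
    (∃[ c ] ((n : ℕ) →
    fromℕ (sum (consecutiveP n (4 ℕ.* N))) ≡ c * fromℕ (P (n ℕ.+ 2 ℕ.* N)))))
-- The value of `b` is a closed computation, as `a` has norm -1. The witness for the constant is the
-- factor in `formula`, which is free of n.
theorem1p6 = refl , λ N → formula N , (a ^ (2 ℕ.* N) - b ^ (2 ℕ.* N)) / √2 , formula N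
  where
  open ≡-Reasoning
  formula : ∀ N n → fromℕ (sum (consecutiveP n (4 ℕ.* N)))
    ≡ (a ^ (2 ℕ.* N) - b ^ (2 ℕ.* N)) / √2 * fromℕ (P (n ℕ.+ 2 ℕ.* N))
  formula N n = begin
    fromℕ (sum (consecutiveP n (4 ℕ.* N)))
      ≡⟨ cong fromℕ (sum-consecutiveP n N) ⟩
    fromℕ (2 ℕ.* P (2 ℕ.* N) ℕ.* P (n ℕ.+ 2 ℕ.* N))
      ≡⟨ fromℕ-homo-* (2 ℕ.* P (2 ℕ.* N)) (P (n ℕ.+ 2 ℕ.* N)) ⟩
    fromℕ (2 ℕ.* P (2 ℕ.* N)) * fromℕ (P (n ℕ.+ 2 ℕ.* N))
      ≡⟨ cong (_* fromℕ (P (n ℕ.+ 2 ℕ.* N))) (binet (2 ℕ.* N)) ⟩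
    (a ^ (2 ℕ.* N) - b ^ (2 ℕ.* N)) / √2 * fromℕ (P (n ℕ.+ 2 ℕ.* N)) ∎
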